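{- Let $\sigma=2153\text{ - }4$ and $\tau=3154\text{ - }2$. For every $n\ge 5$ and all $k,\ell\in\{1,\dots,n\}$ with $k\ne\ell$ the following hold. (a) If $k<\ell<n$, then $T_n(\sigma)[k,\ell]=T_{n-1}(\tau)[\ell]$. If $k<\ell=n$, then $T_n(\sigma)[k,\ell]=T_{n-1}(\tau)[1]$. (b) If $k=n$ and $\ell\ne n-1$, then $T_n(\sigma)[n,\ell]=T_{n-1}(\tau)[\ell+1]$. Also, $T_n(\sigma)[n,n-1]=T_{n-1}(\tau)[n-1]$. (c) If $n>k>\ell+1$, then $T_n(\sigma)[k,\ell]=T_n(\tau)[k+1,\ell+1]$. (d) For any $1\le k<n$, $T_n(\sigma)[k]=T_n(\tau)[k+1]$; and $T_n(\sigma)[n]=T_n(\tau)[1]$. (e) $T_n(\sigma)=T_n(\tau)$. Thus $2153\text{ - }4\equiv 3154\text{ - }2$, i.e. these two patterns are Wilf-equivalent.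
   Context: $S_n$ is the set of permutations of $\{1,\dots,n\}$ in one-line notation. Two sequences of positive integers of the same length are order-isomorphic, $a_1\cdots a_m\sim b_1\cdots b_m$, if for all $p,q$ one has $a_p<a_q$ iff $b_p<b_q$. A permutation $\pi\in S_n$ contains the quasi-consecutive pattern $\rho=\rho_1\rho_2\rho_3\rho_4\text{ - }\rho_5$ (with $\rho_1\cdots\rho_5\in S_5$) if there are indices $1\le i_1<\cdots<i_5\le n$ with $i_{p+1}=i_p+1$ for $p=1,2,3$ and $\pi_{i_1}\cdots\pi_{i_5}\sim\rho_1\cdots\rho_5$; otherwise $\pi$ avoids $\rho$. $T_n(\rho)$ is the number of $\pi\in S_n$ avoiding $\rho$; $T_n(\rho)[k]$ is the number of $\pi\in S_n$ avoiding $\rho$ with $\pi_1=k$; $T_n(\rho)[k,\ell]$ is the number of $\pi\in S_n$ avoiding $\rho$ with $\pi_1=k$ and $\pi_2=\ell$. Patterns $\rho,\rho'$ are Wilf-equivalent, $\rho\equiv\rho'$, if $T_n(\rho)=T_n(\rho')$ for every positive integer $n$. -}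

module Defs where

open import Data.Nat using (ℕ; zero; suc; _≤_; _<_)
open import Data.Nat.Properties using (_≟_; _≤?_; _<?_; suc-injective; <⇒≢)
open import Data.Fin as Fin using (Fin; toℕ)
open import Data.Fin.Properties as Fin using (any?; all?)
open import Data.List using (List; []; _∷_; length; filter; applyUpTo; cartesianProductWith)
open import Data.List.Membership.Propositional using (_∈_)
open import Data.List.Membership.Propositional.Properties
  using (∈-cartesianProductWith⁺; ∈-cartesianProductWith⁻; ∈-applyUpTo⁺; ∈-filter⁺; ∈-filter⁻)
open import Data.List.Relation.Unary.Any using (here)
import Data.List.Relation.Unary.All as List
import Data.List.Relation.Unary.Unique.Propositional as List
import Data.List.Relation.Unary.Unique.Propositional.Properties as List
open import Data.Product using (_×_; _,_; proj₂; ∃; ∃-syntax)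
open import Data.Vec using (Vec; []; _∷_; lookup; map)
open import Data.Vec.Properties using (∷-injective)
open import Data.Vec.Relation.Unary.All as All using (All; []; _∷_)
open import Data.Vec.Relation.Unary.AllPairs using (allPairs?)
open import Data.Vec.Relation.Unary.Unique.Propositional using (Unique)
open import Function using (_∘_; _⇔_; mk⇔; Equivalence)
open import Relation.Binary.PropositionalEquality using (_≡_; refl)
open import Relation.Nullary using (Dec; ¬_)
open import Relation.Nullary.Decidable using (map′; _×-dec_; _→-dec_; ¬?; from-yes)
open import Relation.Unary using (Decidable)

-- One-line notation: π₁ ⋯ πₙ is stored with its 1-based values, while
-- positions are elements of Fin n, so the entry πᵢ is at the index i ∸ 1.
IsPermutation : ∀ {n} → Vec ℕ n → Set
IsPermutation {n} π = All (λ v → 1 ≤ v × v ≤ n) π × Unique π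

isPermutation? : ∀ {n} → Decidable (IsPermutation {n})
isPermutation? {n} π =
  All.all? (λ v → (1 ≤? v) ×-dec (v ≤? n)) π ×-dec allPairs? (λ x y → ¬? (x ≟ y)) π

-- All words of length m over the alphabet {1, …, n}.
words : ℕ → ∀ m → List (Vec ℕ m)
words n zero    = [] ∷ []
words n (suc m) = cartesianProductWith _∷_ (applyUpTo suc n) (words n m)

S : ∀ n → List (Vec ℕ n)
S n = filter isPermutation? (words n n)

-- S n lists every permutation of {1, …, n} exactly once.
∈-words : ∀ n {m} {w : Vec ℕ m} → All (λ v → 1 ≤ v × v ≤ n) w → w ∈ words n m
∈-words n []                          = here refl
∈-words n {w = suc _ ∷ _} ((_ , v<n) ∷ vs) =
  ∈-cartesianProductWith⁺ _∷_ (∈-applyUpTo⁺ suc v<n) (∈-words n vs)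

∈-S : ∀ {n} {π : Vec ℕ n} → π ∈ S n ⇔ IsPermutation π
∈-S {n} = mk⇔
  (λ π∈S → proj₂ (∈-filter⁻ isPermutation? {xs = words n n} π∈S))
  (λ { p@(inRange , _) → ∈-filter⁺ isPermutation? (∈-words n inRange) p })

words-unique : ∀ n m → List.Unique (words n m)
words-unique n zero    = List.[] List.∷ List.[]
words-unique n (suc m) = List.cartesianProductWith⁺ _∷_ ∷-injective
  (List.applyUpTo⁺₁ suc n (λ i<j _ → <⇒≢ i<j ∘ suc-injective)) (words-unique n m)

S-unique : ∀ n → List.Unique (S n)
S-unique n = List.filter⁺ isPermutation? (words-unique n n)

infix 4 _∼_

_∼_ : ∀ {m} → Vec ℕ m → Vec ℕ m → Set
a ∼ b = ∀ p q → lookup a p < lookup a q ⇔ lookup b p < lookup b q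

_∼?_ : ∀ {m} (a b : Vec ℕ m) → Dec (a ∼ b)
a ∼? b = all? λ p → all? λ q →
  map′ (λ (f , g) → mk⇔ f g) (λ e → Equivalence.to e , Equivalence.from e)
    (((lookup a p <? lookup a q) →-dec (lookup b p <? lookup b q)) ×-dec
     ((lookup b p <? lookup b q) →-dec (lookup a p <? lookup a q)))

-- The pattern ρ₁ρ₂ρ₃ρ₄-ρ₅.
record Pattern : Set where
  field
    letters       : Vec ℕ 5
    isPermutation : IsPermutation letters

open Pattern

-- The indices i₁ < ⋯ < i₅ have i₁, i₂, i₃, i₄ consecutive; their first three
-- strict inequalities follow from adjacency and are not repeated.
Contains : ∀ {n} → Pattern → Vec ℕ n → Set
Contains ρ π = ∃[ i₁ ] ∃[ i₂ ] ∃[ i₃ ] ∃[ i₄ ] ∃[ i₅ ]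
  (toℕ i₂ ≡ suc (toℕ i₁) × toℕ i₃ ≡ suc (toℕ i₂) × toℕ i₄ ≡ suc (toℕ i₃) × i₄ Fin.< i₅ ×
   map (lookup π) (i₁ ∷ i₂ ∷ i₃ ∷ i₄ ∷ i₅ ∷ []) ∼ letters ρ)

Avoids : ∀ {n} → Pattern → Vec ℕ n → Set
Avoids ρ π = ¬ Contains ρ π

avoids? : ∀ {n} ρ → Decidable (Avoids {n} ρ)
avoids? ρ π = ¬? (any? λ i₁ → any? λ i₂ → any? λ i₃ → any? λ i₄ → any? λ i₅ →
  (toℕ i₂ ≟ suc (toℕ i₁)) ×-dec (toℕ i₃ ≟ suc (toℕ i₂)) ×-dec (toℕ i₄ ≟ suc (toℕ i₃)) ×-dec
  (i₄ Fin.<? i₅) ×-dec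
  (map (lookup π) (i₁ ∷ i₂ ∷ i₃ ∷ i₄ ∷ i₅ ∷ []) ∼? letters ρ))

-- πₚ = v, with p counted from 1.
Entry : ∀ {n} → ℕ → ℕ → Vec ℕ n → Set
Entry p v π = ∃[ i ] (suc (toℕ i) ≡ p × lookup π i ≡ v)

entry? : ∀ {n} p v → Decidable (Entry {n} p v)
entry? p v π = any? λ i → (suc (toℕ i) ≟ p) ×-dec (lookup π i ≟ v)

countPerms : ∀ n {P : Vec ℕ n → Set} → Decidable P → ℕ
countPerms n P? = length (filter P? (S n))

-- T n ρ is Tₙ(ρ), T₁ n ρ k is Tₙ(ρ)[k], and T₂ n ρ k ℓ is Tₙ(ρ)[k,ℓ].
T : ℕ → Pattern → ℕ
T n ρ = countPerms n (avoids? ρ)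

T₁ : ℕ → Pattern → ℕ → ℕ
T₁ n ρ k = countPerms n (λ π → avoids? ρ π ×-dec entry? 1 k π)

T₂ : ℕ → Pattern → ℕ → ℕ → ℕ
T₂ n ρ k ℓ = countPerms n (λ π → avoids? ρ π ×-dec entry? 1 k π ×-dec entry? 2 ℓ π)

infix 4 _≡ᵂ_

-- Wilf-equivalence.
_≡ᵂ_ : Pattern → Pattern → Set
ρ ≡ᵂ ρ′ = ∀ n → 1 ≤ n → T n ρ ≡ T n ρ′

-- 2153-4
σ : Pattern
σ .letters       = 2 ∷ 1 ∷ 5 ∷ 3 ∷ 4 ∷ []
σ .isPermutation = from-yes (isPermutation? (2 ∷ 1 ∷ 5 ∷ 3 ∷ 4 ∷ []))

-- 3154-2
τ : Pattern
τ .letters       = 3 ∷ 1 ∷ 5 ∷ 4 ∷ 2 ∷ []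
τ .isPermutation = from-yes (isPermutation? (3 ∷ 1 ∷ 5 ∷ 4 ∷ 2 ∷ []))

{-# OPTIONS --safe #-}
module Submission where

-- In an occurrence of 2153-4 at the front of a permutation, no value between the letters 3 and 5
-- is among the first four entries, and likewise for the letters 1 and 3 of 3154-2; so the last
-- letter exists as soon as there is such a value, and the first four entries decide.  Deleting the
-- first entry c and standardising, let d be the first entry of the rest.  The number second ρ m c d
-- of avoiders equals first ρ m d unless c d is a descent (by at least 2 for τ), and then falls short
-- of it by deficit ρ t m c, which does not depend on d.  Induction on the length shows that the
-- counts of σ and τ agree after a cyclic shift of the first entry.

open import Defs
open Pattern using (letters)
open import Data.Bool using (true; false; if_then_else_)
open import Data.Empty using (⊥)
open import Data.Fin as Fin using (Fin; zero; suc; toℕ)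
open import Data.Fin.Patterns
import Data.Fin.Properties as Fin
open import Data.List as List using (List; []; _∷_; applyUpTo; cartesianProductWith; filter; length)
open import Data.List.Membership.Propositional using (_∈_)
open import Data.List.Membership.Propositional.Properties
  using (∈-cartesianProductWith⁺; ∈-cartesianProductWith⁻; ∈-applyUpTo⁺; ∈-applyUpTo⁻)
open import Data.List.Membership.Propositional.Properties.WithK using (unique∧set⇒bag)
import Data.List.Properties as List
open import Data.List.Relation.Binary.BagAndSetEquality using (∼bag⇒↭)
open import Data.List.Relation.Binary.Permutation.Propositional using (_↭_)
import Data.List.Relation.Binary.Permutation.Propositional.Properties as ↭
open import Data.List.Relation.Unary.Any using (here; there)
import Data.List.Relation.Unary.Unique.Propositional.Properties as ListUnique
open import Data.Nat
  using (ℕ; zero; suc; pred; _+_; _*_; _∸_; _≤_; _<_; z≤n; s≤s)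
open import Data.Nat.ListAction using (sum)
open import Data.Nat.ListAction.Properties using (sum-++; sum-↭)
open import Data.Nat.Properties
open import Algebra.Properties.CommutativeSemigroup +-commutativeSemigroup
  using () renaming (interchange to +-interchange; x∙yz≈y∙xz to x+[y+z]≡y+[x+z])
open import Data.Product using (_×_; _,_; proj₁; proj₂; ∃-syntax)
open import Data.Sum using (_⊎_; inj₁; inj₂; [_,_]′)
open import Data.Vec as Vec using (Vec; []; _∷_; map; lookup)
open import Data.Vec.Properties using (∷-injective; map-cong; map-∘; lookup-map)
open import Data.Vec.Relation.Unary.All as All using (All; []; _∷_)
import Data.Vec.Relation.Unary.All.Properties as All
open import Data.Vec.Relation.Unary.AllPairs using (AllPairs; []; _∷_)
open import Data.Vec.Relation.Unary.Unique.Propositional using (Unique)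
import Data.Vec.Relation.Unary.Unique.Propositional.Properties as Unique
open import Function using (_∘_; _⇔_; mk⇔; Equivalence; id)
import Function.Properties.Equivalence as ⇔
open import Relation.Binary using (tri<; tri≈; tri>)
open import Relation.Binary.PropositionalEquality
open import Relation.Nullary using (¬_; Dec; yes; no; does; contradiction)
open import Relation.Nullary.Decidable using (_×-dec_)
open import Relation.Unary using (Decidable)

open Equivalence using (to; from)
open ≡-Reasoning

-- Deleting the first entry of a permutation and standardising the rest

-- The order embedding of ℕ into itself that skips the value c.
bump : ℕ → ℕ → ℕ
bump zero    v       = suc v
bump (suc c) zero    = zero
bump (suc c) (suc v) = suc (bump c v)

unbump : ℕ → ℕ → ℕ
unbump zero    v       = pred v
unbump (suc c) zero    = zero
unbump (suc c) (suc v) = suc (unbump c v)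

bump-< : ∀ {c v} → v < c → bump c v ≡ v
bump-< {suc c} {zero}  _         = refl
bump-< {suc c} {suc v} (s≤s v<c) = cong suc (bump-< v<c)

bump-≥ : ∀ {c v} → c ≤ v → bump c v ≡ suc v
bump-≥ z≤n       = refl
bump-≥ (s≤s c≤v) = cong suc (bump-≥ c≤v)

bump-mono-< : ∀ c {v w} → v < w → bump c v < bump c w
bump-mono-< zero    v<w                     = s≤s v<w
bump-mono-< (suc c) {zero}  {suc w} _       = s≤s z≤n
bump-mono-< (suc c) {suc v} {suc w} (s≤s p) = s≤s (bump-mono-< c p)

bump-cancel-< : ∀ c {v w} → bump c v < bump c w → v < w
bump-cancel-< zero    (s≤s p)                 = p
bump-cancel-< (suc c) {zero}  {suc w} _       = s≤s z≤n
bump-cancel-< (suc c) {suc v} {suc w} (s≤s p) = s≤s (bump-cancel-< c p)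

bump-injective : ∀ c {v w} → bump c v ≡ bump c w → v ≡ w
bump-injective zero    eq                  = suc-injective eq
bump-injective (suc c) {zero}  {zero}  _   = refl
bump-injective (suc c) {suc v} {suc w} eq  = cong suc (bump-injective c (suc-injective eq))

bump-≢ : ∀ c {v} → bump c v ≢ c
bump-≢ (suc c) {suc v} eq = bump-≢ c (suc-injective eq)

bump-≤ : ∀ c v → bump c v ≤ suc v
bump-≤ zero    v       = ≤-refl
bump-≤ (suc c) zero    = z≤n
bump-≤ (suc c) (suc v) = s≤s (bump-≤ c v)

≤-bump : ∀ c v → v ≤ bump c v
≤-bump zero    v       = n≤1+n v
≤-bump (suc c) zero    = z≤n
≤-bump (suc c) (suc v) = s≤s (≤-bump c v)

bump-unbump : ∀ {c v} → c ≢ v → bump c (unbump c v) ≡ v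
bump-unbump {zero}  {zero}  c≢v = contradiction refl c≢v
bump-unbump {zero}  {suc v} c≢v = refl
bump-unbump {suc c} {zero}  c≢v = refl
bump-unbump {suc c} {suc v} c≢v = cong suc (bump-unbump (c≢v ∘ cong suc))

map-injective : ∀ {A B : Set} {h : A → B} → (∀ {x y} → h x ≡ h y → x ≡ y) →
  ∀ {n} {v w : Vec A n} → map h v ≡ map h w → v ≡ w
map-injective h-inj {v = []}    {[]}    _  = refl
map-injective h-inj {v = x ∷ v} {y ∷ w} eq with ∷-injective eq
... | hx≡hy , eq′ = cong₂ _∷_ (h-inj hx≡hy) (map-injective h-inj eq′)

-- The permutation with first entry c whose remaining entries are ordered like w.
ins : ∀ {n} → ℕ → Vec ℕ n → Vec ℕ (suc n)
ins c w = c ∷ map (bump c) w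

InRange : ℕ → ℕ → Set
InRange n v = 1 ≤ v × v ≤ n

bump-inRange : ∀ c {n v} → InRange n v → InRange (suc n) (bump c v)
bump-inRange c {v = v} (1≤v , v≤n) = ≤-trans 1≤v (≤-bump c v) , ≤-trans (bump-≤ c v) (s≤s v≤n)

unbump-inRange : ∀ {c n v} → InRange (suc n) c → InRange (suc n) (bump c v) → InRange n v
unbump-inRange {c} {n} {v} (1≤c , c≤n) (1≤b , b≤n) with v <? c
... | yes v<c = subst (1 ≤_) (bump-< v<c) 1≤b , ≤-pred (≤-trans v<c c≤n)
... | no  v≮c = ≤-trans 1≤c c≤v , ≤-pred (subst (_≤ suc n) (bump-≥ c≤v) b≤n)
  where c≤v = ≮⇒≥ v≮c

unique-map⁻ : ∀ {A B : Set} (h : A → B) {n} {xs : Vec A n} → Unique (map h xs) → Unique xs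
unique-map⁻ h {xs = []}     []          = []
unique-map⁻ h {xs = x ∷ xs} (x∉xs ∷ xs!) =
  All.map (λ hx≢hy → hx≢hy ∘ cong h) (All.map⁻ x∉xs) ∷ unique-map⁻ h xs!

ins-isPermutation : ∀ {n c} {w : Vec ℕ n} → InRange (suc n) c → IsPermutation w → IsPermutation (ins c w)
ins-isPermutation {c = c} c∈ (w∈ , w!) =
  c∈ ∷ All.map⁺ (All.map (bump-inRange c) w∈) ,
  All.map⁺ (All.universal (λ _ → bump-≢ c ∘ sym) _) ∷ Unique.map⁺ (bump-injective c) w!

map-bump-unbump : ∀ {n c} {t : Vec ℕ n} → All (c ≢_) t → map (bump c) (map (unbump c) t) ≡ t
map-bump-unbump []           = refl
map-bump-unbump (c≢v ∷ c∉t) = cong₂ _∷_ (bump-unbump c≢v) (map-bump-unbump c∉t)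

ins-surjective : ∀ {n} {π : Vec ℕ (suc n)} → IsPermutation π →
  ∃[ c ] ∃[ w ] InRange (suc n) c × IsPermutation w × π ≡ ins c w
ins-surjective {π = c ∷ t} (c∈ ∷ t∈ , c∉t ∷ t!) =
  c , map (unbump c) t , c∈ ,
  (All.map (unbump-inRange c∈) (All.map⁻ (subst (All _) (sym eq) t∈)) ,
   unique-map⁻ (bump c) (subst Unique (sym eq) t!)) ,
  cong (c ∷_) (sym eq)
  where eq = map-bump-unbump c∉t

-- Induction by deleting the first entry `c`: a value other than `c` standardises to a value of the
-- shorter permutation. This later supplies the last letter of an occurrence.
perm-surjective : ∀ {n v} {w : Vec ℕ n} → IsPermutation w → InRange n v → ∃[ i ] lookup w i ≡ v
perm-surjective {zero}  _ (s≤s _ , ())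
perm-surjective {suc n} {v} isPerm v∈ with ins-surjective isPerm
... | c , w , c∈ , w-perm , refl with c ≟ v
...   | yes c≡v = zero , c≡v
...   | no  c≢v with perm-surjective w-perm (unbump-inRange c∈ (subst (InRange _) (sym (bump-unbump c≢v)) v∈))
...     | i , eq = suc i , trans (lookup-map i (bump c) w) (trans (cong (bump c) eq) (bump-unbump c≢v))

-- Sums over permutations, split by the first entry

∑ : ℕ → (ℕ → ℕ) → ℕ
∑ n F = sum (applyUpTo F n)

permSum : ∀ n → (Vec ℕ n → ℕ) → ℕ
permSum n F = sum (List.map F (S n))

-- Both lists are free of repetitions and have the same members, so they are rearrangements of each
-- other, which is all that a sum can see.
S-suc : ∀ n → S (suc n) ↭ cartesianProductWith ins (applyUpTo suc (suc n)) (S n)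
S-suc n = ∼bag⇒↭ (unique∧set⇒bag (S-unique (suc n))
  (ListUnique.cartesianProductWith⁺ ins ins-injective
    (ListUnique.applyUpTo⁺₁ suc (suc n) (λ i<j _ → <⇒≢ i<j ∘ suc-injective)) (S-unique n))
  (mk⇔ decompose compose))
  where
  ins-injective : ∀ {c d} {v w : Vec ℕ n} → ins c v ≡ ins d w → c ≡ d × v ≡ w
  ins-injective {c} eq with ∷-injective eq
  ... | refl , eq′ = refl , map-injective (bump-injective c) eq′
  decompose : ∀ {π} → π ∈ S (suc n) → π ∈ cartesianProductWith ins (applyUpTo suc (suc n)) (S n)
  decompose π∈ with ins-surjective (to ∈-S π∈)
  ... | suc c , w , (_ , c<n) , w-perm , refl =
    ∈-cartesianProductWith⁺ ins (∈-applyUpTo⁺ suc c<n) (from ∈-S w-perm)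
  compose : ∀ {π} → π ∈ cartesianProductWith ins (applyUpTo suc (suc n)) (S n) → π ∈ S (suc n)
  compose π∈ with ∈-cartesianProductWith⁻ ins (applyUpTo suc (suc n)) (S n) π∈
  ... | c , w , c∈ , w∈ , refl with ∈-applyUpTo⁻ suc c∈
  ... | i , i<n , refl =
    from ∈-S (ins-isPermutation (s≤s z≤n , i<n) (to ∈-S w∈))

sum-map-cartesianProductWith : ∀ {A B C : Set} (F : C → ℕ) (f : A → B → C) xs ys →
  sum (List.map F (cartesianProductWith f xs ys)) ≡
  sum (List.map (λ x → sum (List.map (F ∘ f x) ys)) xs)
sum-map-cartesianProductWith F f []       ys = refl
sum-map-cartesianProductWith F f (x ∷ xs) ys = begin
  sum (List.map F (List.map (f x) ys List.++ zs))
    ≡⟨ cong sum (List.map-++ F (List.map (f x) ys) zs) ⟩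
  sum (List.map F (List.map (f x) ys) List.++ List.map F zs)
    ≡⟨ sum-++ (List.map F (List.map (f x) ys)) (List.map F zs) ⟩
  sum (List.map F (List.map (f x) ys)) + sum (List.map F zs)
    ≡⟨ cong₂ _+_ (cong sum (sym (List.map-∘ ys))) (sum-map-cartesianProductWith F f xs ys) ⟩
  _ ∎
  where
  zs = cartesianProductWith f xs ys

permSum-suc : ∀ n F → permSum (suc n) F ≡ ∑ (suc n) (λ i → permSum n (F ∘ ins (suc i)))
permSum-suc n F = begin
  sum (List.map F (S (suc n)))
    ≡⟨ sum-↭ (↭.map⁺ F (S-suc n)) ⟩
  sum (List.map F (cartesianProductWith ins (applyUpTo suc (suc n)) (S n)))
    ≡⟨ sum-map-cartesianProductWith F ins (applyUpTo suc (suc n)) (S n) ⟩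
  sum (List.map (λ c → permSum n (F ∘ ins c)) (applyUpTo suc (suc n)))
    ≡⟨ cong sum (List.map-applyUpTo suc (λ c → permSum n (F ∘ ins c)) (suc n)) ⟩
  _ ∎

sum-map-cong : ∀ {A : Set} {F G : A → ℕ} xs → (∀ {x} → x ∈ xs → F x ≡ G x) →
  sum (List.map F xs) ≡ sum (List.map G xs)
sum-map-cong []       F≗G = refl
sum-map-cong (x ∷ xs) F≗G = cong₂ _+_ (F≗G (here refl)) (sum-map-cong xs (F≗G ∘ there))

sum-map-+ : ∀ {A : Set} (F G : A → ℕ) xs →
  sum (List.map (λ x → F x + G x) xs) ≡ sum (List.map F xs) + sum (List.map G xs)
sum-map-+ F G []       = refl
sum-map-+ F G (x ∷ xs) rewrite sum-map-+ F G xs = +-interchange (F x) (G x) _ _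

sum-map-* : ∀ {A : Set} k (F : A → ℕ) xs →
  sum (List.map (λ x → k * F x) xs) ≡ k * sum (List.map F xs)
sum-map-* k F []       = sym (*-zeroʳ k)
sum-map-* k F (x ∷ xs) = trans (cong (k * F x +_) (sum-map-* k F xs)) (sym (*-distribˡ-+ k (F x) _))

permSum-cong : ∀ {n} {F G : Vec ℕ n → ℕ} → (∀ {w} → IsPermutation w → F w ≡ G w) →
  permSum n F ≡ permSum n G
permSum-cong {n} F≗G = sum-map-cong (S n) (F≗G ∘ to ∈-S)

∑-cong : ∀ {n F G} → (∀ {i} → i < n → F i ≡ G i) → ∑ n F ≡ ∑ n G
∑-cong {zero}  F≗G = refl
∑-cong {suc n} F≗G = cong₂ _+_ (F≗G (s≤s z≤n)) (∑-cong {n} (F≗G ∘ s≤s))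

-- Occurrences at the front and occurrences in the tail

data Starts (ρ : Pattern) : ∀ {n} → Vec ℕ n → Set where
  starts : ∀ {a b c d n} {t : Vec ℕ n} j → (a ∷ b ∷ c ∷ d ∷ lookup t j ∷ []) ∼ letters ρ →
    Starts ρ (a ∷ b ∷ c ∷ d ∷ t)

contains-∷⁺ : ∀ {ρ n x} {v : Vec ℕ n} → Starts ρ (x ∷ v) ⊎ Contains ρ v → Contains ρ (x ∷ v)
contains-∷⁺ (inj₁ (starts j iso)) =
  0F , 1F , 2F , 3F , suc (suc (suc (suc j))) , refl , refl , refl , s≤s (s≤s (s≤s (s≤s z≤n))) , iso
contains-∷⁺ (inj₂ (i₁ , i₂ , i₃ , i₄ , i₅ , p , q , r , i₄<i₅ , iso)) =
  suc i₁ , suc i₂ , suc i₃ , suc i₄ , suc i₅ , cong suc p , cong suc q , cong suc r , s≤s i₄<i₅ , iso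

-- Adjacency leaves two cases: if `i₁` is zero, the four consecutive letters are the first four
-- entries; otherwise the whole occurrence lies in the tail.
contains-∷⁻ : ∀ {ρ n x} {v : Vec ℕ n} → Contains ρ (x ∷ v) → Starts ρ (x ∷ v) ⊎ Contains ρ v
contains-∷⁻ {v = b ∷ c ∷ d ∷ t}
  (zero , suc zero , suc (suc zero) , suc (suc (suc zero)) , suc (suc (suc (suc j))) ,
   _ , _ , _ , s≤s (s≤s (s≤s (s≤s _))) , iso) =
  inj₁ (starts j iso)
contains-∷⁻ {v = _ ∷ []} (zero , suc zero , suc (suc ()) , _)
contains-∷⁻ {v = _ ∷ _ ∷ []} (zero , suc zero , suc (suc zero) , suc (suc (suc ())) , _)
contains-∷⁻ (suc i₁ , suc i₂ , suc i₃ , suc i₄ , suc i₅ , p , q , r , s≤s i₄<i₅ , iso) =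
  inj₂ (i₁ , i₂ , i₃ , i₄ , i₅ , suc-injective p , suc-injective q , suc-injective r , i₄<i₅ , iso)

∼-map : ∀ {h : ℕ → ℕ} → (∀ {x y} → x < y ⇔ h x < h y) →
  ∀ {m} (a b : Vec ℕ m) → map h a ∼ b ⇔ a ∼ b
∼-map {h} h-mono a b = mk⇔
  (λ iso p q → ⇔.trans (step p q) (iso p q))
  (λ iso p q → ⇔.trans (⇔.sym (step p q)) (iso p q))
  where
  step : ∀ p q → lookup a p < lookup a q ⇔ lookup (map h a) p < lookup (map h a) q
  step p q rewrite lookup-map p h a | lookup-map q h a = h-mono

contains-map : ∀ {h : ℕ → ℕ} → (∀ {x y} → x < y ⇔ h x < h y) →
  ∀ ρ {n} (v : Vec ℕ n) → Contains ρ (map h v) ⇔ Contains ρ v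
contains-map {h} h-mono ρ v = mk⇔
  (λ { (i₁ , i₂ , i₃ , i₄ , i₅ , p , q , r , i₄<i₅ , iso) →
    i₁ , i₂ , i₃ , i₄ , i₅ , p , q , r , i₄<i₅ , to (iso⇔ (i₁ ∷ i₂ ∷ i₃ ∷ i₄ ∷ i₅ ∷ [])) iso })
  (λ { (i₁ , i₂ , i₃ , i₄ , i₅ , p , q , r , i₄<i₅ , iso) →
    i₁ , i₂ , i₃ , i₄ , i₅ , p , q , r , i₄<i₅ , from (iso⇔ (i₁ ∷ i₂ ∷ i₃ ∷ i₄ ∷ i₅ ∷ [])) iso })
  where
  iso⇔ : ∀ is → map (lookup (map h v)) is ∼ letters ρ ⇔ map (lookup v) is ∼ letters ρ
  iso⇔ is rewrite trans (map-cong (λ i → lookup-map i h v) is) (map-∘ h (lookup v) is) =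
    ∼-map h-mono (map (lookup v) is) (letters ρ)

-- `bump c` preserves and reflects order, so the tail of `ins c w` contains `ρ` exactly when `w`
-- does.
avoids-ins : ∀ {ρ n c} {w : Vec ℕ n} → Avoids ρ (ins c w) ⇔ (¬ Starts ρ (ins c w) × Avoids ρ w)
avoids-ins {ρ} {c = c} {w} = mk⇔
  (λ av → av ∘ contains-∷⁺ {ρ} ∘ inj₁ , av ∘ contains-∷⁺ {ρ} ∘ inj₂ ∘ from contains-bump)
  (λ { (¬st , av) → [ ¬st , av ∘ to contains-bump ]′ ∘ contains-∷⁻ {ρ} })
  where contains-bump = contains-map (mk⇔ (bump-mono-< c) (bump-cancel-< c)) ρ w

-- The two patterns as chains of inequalities

lookup-mono-< : ∀ {n} {s : Vec ℕ n} → AllPairs _<_ s → ∀ {i j} → i Fin.< j → lookup s i < lookup s j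
lookup-mono-< (x<s ∷ _)  {zero}  {suc j} _         = All.lookup⁺ x<s j
lookup-mono-< (_ ∷ s<) {suc i} {suc j} (s≤s i<j) = lookup-mono-< s< i<j

-- Here `s` lists the values in increasing order and `r` the rank of each entry, counted from 0; the
-- pattern letters are the ranks counted from 1. Order-isomorphism thus reduces to a chain of
-- inequalities.
sorted-∼ : ∀ {n m} {s : Vec ℕ n} → AllPairs _<_ s → (r : Vec (Fin n) m) →
  map (lookup s) r ∼ map (λ i → ℕ.suc (toℕ i)) r
sorted-∼ {s = s} s< r p q
  rewrite lookup-map p (lookup s) r | lookup-map q (lookup s) r
        | lookup-map p (λ i → ℕ.suc (toℕ i)) r | lookup-map q (λ i → ℕ.suc (toℕ i)) r =
  mk⇔ cancel (λ { (s≤s i<j) → lookup-mono-< s< i<j })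
  where
  cancel : ∀ {i j} → lookup s i < lookup s j → suc (toℕ i) < suc (toℕ j)
  cancel {i} {j} si<sj with Fin.<-cmp i j
  ... | tri< i<j _ _  = s≤s i<j
  ... | tri≈ _ refl _ = contradiction si<sj (<-irrefl refl)
  ... | tri> _ _ j<i  = contradiction si<sj (<-asym (lookup-mono-< s< j<i))

chain : ∀ {a b c d e} → a < b → b < c → c < d → d < e → AllPairs _<_ (a ∷ b ∷ c ∷ d ∷ e ∷ [])
chain a<b b<c c<d d<e =
  (a<b ∷ a<c ∷ <-trans a<c c<d ∷ <-trans a<c (<-trans c<d d<e) ∷ []) ∷
  (b<c ∷ b<d ∷ <-trans b<d d<e ∷ []) ∷ (c<d ∷ <-trans c<d d<e ∷ []) ∷ (d<e ∷ []) ∷ [] ∷ []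
  where
  a<c = <-trans a<b b<c
  b<d = <-trans b<c c<d

∼σ : ∀ {a b c d e} → (a ∷ b ∷ c ∷ d ∷ e ∷ []) ∼ letters σ ⇔ (b < a × a < d × d < e × e < c)
∼σ = mk⇔
  (λ iso → from (iso 1F 0F) (n<1+n 1) , from (iso 0F 3F) (n<1+n 2) ,
         from (iso 3F 4F) (n<1+n 3) , from (iso 4F 2F) (n<1+n 4))
  -- The indices are the letters of 2153-4, each lowered by one.
  (λ { (b<a , a<d , d<e , e<c) → sorted-∼ (chain b<a a<d d<e e<c) (1F ∷ 0F ∷ 4F ∷ 2F ∷ 3F ∷ []) })

∼τ : ∀ {a b c d e} → (a ∷ b ∷ c ∷ d ∷ e ∷ []) ∼ letters τ ⇔ (b < e × e < a × a < d × d < c)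
∼τ = mk⇔
  (λ iso → from (iso 1F 4F) (n<1+n 1) , from (iso 4F 0F) (n<1+n 2) ,
         from (iso 0F 3F) (n<1+n 3) , from (iso 3F 2F) (n<1+n 4))
  (λ { (b<e , e<a , a<d , d<c) → sorted-∼ (chain b<e e<a a<d d<c) (2F ∷ 0F ∷ 4F ∷ 3F ∷ 1F ∷ []) })

-- Front occurrences decided by the first four entries

-- The entries a b at positions 3 and 4, standardised after the removal of the first two
-- entries, that make an occurrence at the front possible: a descent by more than t with
-- both values above the first entry c (c ≤ suc b, as one removed value lies below b).
HighDescent : ℕ → ℕ → ∀ {n} → Vec ℕ n → Set
HighDescent t c (a ∷ b ∷ _) = c ≤ suc b × t + b < a
HighDescent t c _           = ⊥

highDescent? : ∀ t c {n} (w : Vec ℕ n) → Dec (HighDescent t c w)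
highDescent? t c []          = no id
highDescent? t c (_ ∷ [])    = no id
highDescent? t c (a ∷ b ∷ _) = (c ≤? suc b) ×-dec (t + b <? a)

-- (s , t) is (0 , 1) for σ and (1 , 0) for τ: of the two descents in an occurrence, the one
-- that must enclose a further value needs a drop of at least 2.
record StartsAt (ρ : Pattern) (s t : ℕ) : Set where
  field
    descent    : ∀ {n a b} {v : Vec ℕ n} → Starts ρ (a ∷ b ∷ v) → b < a
    starts-ins : ∀ {n c d} {w : Vec ℕ n} → IsPermutation w → 1 ≤ d →
      Starts ρ (ins c (ins d w)) ⇔ (s + d < c × HighDescent t c w)

<-bump : ∀ {c v} → c ≤ v → c < bump c v
<-bump {c} c≤v = subst (c <_) (sym (bump-≥ c≤v)) (s≤s c≤v)

<-bump⁻ : ∀ {c v} → c < bump c v → c ≤ v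
<-bump⁻ {c} {v} c<bv with v <? c
... | yes v<c = contradiction (subst (c <_) (bump-< v<c) c<bv) (<-asym v<c)
... | no  v≮c = ≮⇒≥ v≮c

bump-<⁻ : ∀ {c v} → bump c v < c → v < c
bump-<⁻ {c} {v} = ≤-<-trans (≤-bump c v)

-- If `b < d`, both inequalities fail because `suc b ≤ d < c`; otherwise `bump d b` is `suc b`.
≤-bump-suc : ∀ {c d b} → d < c → c ≤ bump d b ⇔ c ≤ suc b
≤-bump-suc {c} {d} {b} d<c with b <? d
... | yes b<d = mk⇔ (λ c≤ → ≤-trans c≤ (bump-≤ d b)) (λ c≤ → contradiction (≤-<-trans b<d d<c) (≤⇒≯ c≤))
... | no  b≮d = subst (λ x → c ≤ x ⇔ c ≤ suc b) (sym (bump-≥ (≮⇒≥ b≮d))) ⇔.refl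

tail-surjective : ∀ {n a b v} {t : Vec ℕ n} → IsPermutation (a ∷ b ∷ t) →
  InRange (2 + n) v → v ≢ a → v ≢ b → ∃[ i ] lookup t i ≡ v
tail-surjective perm v∈ v≢a v≢b with perm-surjective perm v∈
... | zero        , a≡v = contradiction (sym a≡v) v≢a
... | suc zero    , b≡v = contradiction (sym b≡v) v≢b
... | suc (suc i) , eq  = i , eq

lookup-bump² : ∀ c d {n} (t : Vec ℕ n) i →
  lookup (map (bump c) (map (bump d) t)) i ≡ bump c (bump d (lookup t i))
lookup-bump² c d t i = trans (lookup-map i (bump c) (map (bump d) t)) (cong (bump c) (lookup-map i (bump d) t))

bump²-mono : ∀ c d {x y} → x < y → bump c (bump d x) < bump c (bump d y)
bump²-mono c d = bump-mono-< c ∘ bump-mono-< d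

bump²-cancel : ∀ c d {x y} → bump c (bump d x) < bump c (bump d y) → x < y
bump²-cancel c d = bump-cancel-< d ∘ bump-cancel-< c

σ-starts : StartsAt σ 0 1
σ-starts = record
  { descent    = λ { (starts j iso) → proj₁ (to ∼σ iso) }
  ; starts-ins = λ {_} {c} {d} {w} perm _ → mk⇔ (occurs⇒ {w = w}) (⇒occurs perm)
  }
  where
  occurs⇒ : ∀ {n c d} {w : Vec ℕ n} → Starts σ (ins c (ins d w)) → d < c × HighDescent 1 c w
  occurs⇒ {c = c} {d} {_ ∷ _ ∷ t} (starts j iso)
    with q , r , s , u ← to ∼σ (subst (λ e → (_ ∷ _ ∷ _ ∷ _ ∷ e ∷ []) ∼ letters σ) (lookup-bump² c d t j) iso) =
    d<c , to (≤-bump-suc d<c) (<-bump⁻ r) , <-≤-trans (s≤s (bump²-cancel c d s)) (bump²-cancel c d u)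
    where d<c = bump-<⁻ q
  ⇒occurs : ∀ {n c d} {w : Vec ℕ n} → IsPermutation w → d < c × HighDescent 1 c w → Starts σ (ins c (ins d w))
  ⇒occurs {c = c} {d} {a ∷ b ∷ t} perm@(((_ , a≤n) ∷ _) , _) (d<c , c≤1+b , 1+b<a)
    -- The last letter is the value `suc b` of `w`. The drop by at least 2 keeps it strictly below
    -- `a`, so it stands after both `a` and `b`.
    with i , eq ← tail-surjective perm (s≤s z≤n , <⇒≤ (<-≤-trans 1+b<a a≤n)) (<⇒≢ 1+b<a) 1+n≢n =
    starts i (subst (λ e → (_ ∷ _ ∷ _ ∷ _ ∷ e ∷ []) ∼ letters σ)
      (sym (trans (lookup-bump² c d t i) (cong (bump c ∘ bump d) eq)))
      (from ∼σ (subst (_< c) (sym (bump-< d<c)) d<c , <-bump (from (≤-bump-suc d<c) c≤1+b)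
               , bump²-mono c d (n<1+n b) , bump²-mono c d 1+b<a)))

τ-starts : StartsAt τ 1 0
τ-starts = record
  { descent    = λ { (starts j iso) → let b<e , e<a , _ = to ∼τ iso in <-trans b<e e<a }
  ; starts-ins = λ {_} {c} {d} {w} perm 1≤d → mk⇔ (occurs⇒ {w = w}) (⇒occurs perm 1≤d)
  }
  where
  occurs⇒ : ∀ {n c d} {w : Vec ℕ n} → Starts τ (ins c (ins d w)) → suc d < c × HighDescent 0 c w
  occurs⇒ {c = c} {d} {_ ∷ _ ∷ t} (starts j iso)
    with b<e , e<a , r , s ← to ∼τ iso =
    ≤-<-trans (≤-<-trans (≤-bump c d) b<e) e<a , to (≤-bump-suc d<c) (<-bump⁻ r) , bump²-cancel c d s
    where d<c = bump-<⁻ (<-trans b<e e<a)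
  ⇒occurs : ∀ {n c d} {w : Vec ℕ n} → IsPermutation w → 1 ≤ d →
    suc d < c × HighDescent 0 c w → Starts τ (ins c (ins d w))
  ⇒occurs {c = c} {d} {a ∷ b ∷ t} perm@((_ ∷ (_ , b≤n) ∷ _) , _) 1≤d (1+d<c , c≤1+b , b<a)
    with d<b ← ≤-pred (<-≤-trans 1+d<c c≤1+b)
    -- The last letter is the value `d` of `w`; being below `b` and `a`, it stands after them. The
    -- two insertions turn it into `suc d`, strictly between the second entry `d` and the first
    -- entry `c`.
    with i , eq ← tail-surjective perm (1≤d , <⇒≤ (<-≤-trans d<b b≤n)) (<⇒≢ (<-trans d<b b<a)) (<⇒≢ d<b) =
    starts i (subst (λ e → (_ ∷ _ ∷ _ ∷ _ ∷ e ∷ []) ∼ letters τ)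
      (sym (trans (lookup-bump² c d t i) (trans (cong (bump c ∘ bump d) eq)
        (trans (cong (bump c) (bump-≥ {d} ≤-refl)) (bump-< 1+d<c)))))
      (from ∼τ (subst (_< suc d) (sym (bump-< d<c)) (n<1+n d) , 1+d<c
               , <-bump (from (≤-bump-suc d<c) c≤1+b) , bump²-mono c d b<a)))
    where d<c = <-trans (n<1+n d) 1+d<c

-- Indicators of avoidance and the effect of a new first entry

ind : ∀ {P : Set} → Dec P → ℕ
ind P? = if does P? then 1 else 0

ind-yes : ∀ {P : Set} (P? : Dec P) → P → ind P? ≡ 1
ind-yes (yes _)  _ = refl
ind-yes (no ¬p)  p = contradiction p ¬p

ind-no : ∀ {P : Set} (P? : Dec P) → ¬ P → ind P? ≡ 0
ind-no (yes p) ¬p = contradiction p ¬p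
ind-no (no _)  _  = refl

ind-cong : ∀ {P Q : Set} (P? : Dec P) (Q? : Dec Q) → P ⇔ Q → ind P? ≡ ind Q?
ind-cong P? (yes q) P⇔Q = ind-yes P? (from P⇔Q q)
ind-cong P? (no ¬q) P⇔Q = ind-no P? (¬q ∘ to P⇔Q)

-- Opaque because unfolding the search in avoids? makes conversion checking infeasible.
opaque
  χ : Pattern → ∀ {n} → Vec ℕ n → ℕ
  χ ρ v = ind (avoids? ρ v)

  χ≡ind : ∀ ρ {n} (v : Vec ℕ n) → χ ρ v ≡ ind (avoids? ρ v)
  χ≡ind ρ v = refl

χ-ins : ∀ {ρ n c} {w : Vec ℕ n} → ¬ Starts ρ (ins c w) → χ ρ (ins c w) ≡ χ ρ w
χ-ins {ρ} {c = c} {w} ¬st = trans (χ≡ind ρ (ins c w)) (trans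
  (ind-cong (avoids? ρ (ins c w)) (avoids? ρ w)
    (mk⇔ (proj₂ ∘ to (avoids-ins {ρ})) (λ av → from (avoids-ins {ρ}) (¬st , av))))
  (sym (χ≡ind ρ w)))

χ-starts : ∀ {ρ n c} {w : Vec ℕ n} → Starts ρ (ins c w) → χ ρ (ins c w) ≡ 0
χ-starts {ρ} {c = c} {w} st = trans (χ≡ind ρ (ins c w))
  (ind-no (avoids? ρ (ins c w)) (λ av → proj₁ (to (avoids-ins {ρ}) av) st))

module _ {ρ s t} (at : StartsAt ρ s t) where
  open StartsAt at

  χ-free : ∀ {n c d} {w : Vec ℕ n} → IsPermutation w → 1 ≤ d → ¬ s + d < c →
    χ ρ (ins c (ins d w)) ≡ χ ρ (ins d w)
  χ-free perm 1≤d ≮ = χ-ins {ρ} (≮ ∘ proj₁ ∘ to (starts-ins perm 1≤d))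

  -- The initial descent of an occurrence at the front of `ins d w` would give `a < d`, whereas the
  -- high descent gives `d ≤ b < a`.
  highDescent⇒¬starts : ∀ {n c d} {w : Vec ℕ n} → s + d < c → HighDescent t c w → ¬ Starts ρ (ins d w)
  highDescent⇒¬starts {c = c} {d} {a ∷ b ∷ _} s+d<c (c≤1+b , t+b<a) st = <⇒≱ a<d (≤-trans d≤b (<⇒≤ b<a))
    where
    a<d = bump-<⁻ (descent st)
    b<a = ≤-<-trans (m≤n+m b t) t+b<a
    d≤b = ≤-pred (<-≤-trans (≤-<-trans (m≤n+m d s) s+d<c) c≤1+b)

  -- Without a high descent, `c` creates no front occurrence. With one, it always does, while
  -- `ins d w` avoids `ρ` exactly when `w` does; the loss is therefore `χ ρ w`, whatever `d` is.
  χ-restricted : ∀ {n c d} {w : Vec ℕ n} → IsPermutation w → 1 ≤ d → s + d < c →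
    χ ρ (ins c (ins d w)) + ind (highDescent? t c w) * χ ρ w ≡ χ ρ (ins d w)
  χ-restricted {c = c} {d} {w} perm 1≤d s+d<c = by (highDescent? t c w)
    where
    by : (hd? : Dec (HighDescent t c w)) → χ ρ (ins c (ins d w)) + ind hd? * χ ρ w ≡ χ ρ (ins d w)
    by (yes hd) = trans
      (cong₂ _+_ (χ-starts {ρ} (from (starts-ins perm 1≤d) (s+d<c , hd))) (*-identityˡ (χ ρ w)))
      (sym (χ-ins {ρ} (highDescent⇒¬starts {w = w} s+d<c hd)))
    by (no ¬hd) = trans (+-identityʳ _) (χ-ins {ρ} (¬hd ∘ proj₂ ∘ to (starts-ins perm 1≤d)))

-- Finite sums: rotation, adjustment of one term, interchange

∑-zero : ∀ n {F} → (∀ {i} → i < n → F i ≡ 0) → ∑ n F ≡ 0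
∑-zero zero    F≡0 = refl
∑-zero (suc n) F≡0 = cong₂ _+_ (F≡0 (s≤s z≤n)) (∑-zero n (F≡0 ∘ s≤s))

∑-last : ∀ n F → ∑ (suc n) F ≡ ∑ n F + F n
∑-last zero    F = +-identityʳ (F 0)
∑-last (suc n) F = trans (cong (F 0 +_) (∑-last n (F ∘ suc))) (sym (+-assoc (F 0) _ _))

∑-cyclic : ∀ n F G → (∀ {i} → i < n → F i ≡ G (suc i)) → F n ≡ G 0 → ∑ (suc n) F ≡ ∑ (suc n) G
∑-cyclic n F G F≗G last = begin
  ∑ (suc n) F           ≡⟨ ∑-last n F ⟩
  ∑ n F + F n           ≡⟨ cong₂ _+_ (∑-cong {n} F≗G) last ⟩
  ∑ n (G ∘ suc) + G 0   ≡⟨ +-comm _ (G 0) ⟩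
  ∑ (suc n) G           ∎

∑-adjust : ∀ n {F G e b} → e < n → F e + b ≡ G e → (∀ {i} → i < n → i ≢ e → F i ≡ G i) →
  ∑ n F + b ≡ ∑ n G
∑-adjust (suc n) {F} {G} {zero} {b} _ at off = begin
  F 0 + ∑ n (F ∘ suc) + b   ≡⟨ +-assoc (F 0) _ b ⟩
  F 0 + (∑ n (F ∘ suc) + b) ≡⟨ cong (F 0 +_) (+-comm _ b) ⟩
  F 0 + (b + ∑ n (F ∘ suc)) ≡⟨ +-assoc (F 0) b _ ⟨
  F 0 + b + ∑ n (F ∘ suc)   ≡⟨ cong₂ _+_ at (∑-cong {n} (λ i<n → off (s≤s i<n) λ ())) ⟩
  G 0 + ∑ n (G ∘ suc)       ∎
∑-adjust (suc n) {F} {G} {suc e} {b} (s≤s e<n) at off = begin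
  F 0 + ∑ n (F ∘ suc) + b   ≡⟨ +-assoc (F 0) _ b ⟩
  F 0 + (∑ n (F ∘ suc) + b)
    ≡⟨ cong₂ _+_ (off (s≤s z≤n) λ ()) (∑-adjust n e<n at (λ i<n i≢e → off (s≤s i<n) (i≢e ∘ suc-injective))) ⟩
  G 0 + ∑ n (G ∘ suc)       ∎

∑-single : ∀ n {F e} → e < n → (∀ {i} → i < n → i ≢ e → F i ≡ 0) → ∑ n F ≡ F e
∑-single n {F} {e} e<n off = begin
  ∑ n F               ≡⟨ ∑-adjust n {λ _ → 0} e<n refl (λ i<n → sym ∘ off i<n) ⟨
  ∑ n (λ _ → 0) + F e ≡⟨ cong (_+ F e) (∑-zero n {λ _ → 0} (λ _ → refl)) ⟩
  F e                 ∎

∑-+ : ∀ n F G → ∑ n (λ i → F i + G i) ≡ ∑ n F + ∑ n G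
∑-+ zero    F G = refl
∑-+ (suc n) F G = trans (cong (F 0 + G 0 +_) (∑-+ n (F ∘ suc) (G ∘ suc))) (+-interchange (F 0) (G 0) _ _)

∑-* : ∀ n k F → ∑ n (λ i → k * F i) ≡ k * ∑ n F
∑-* zero    k F = sym (*-zeroʳ k)
∑-* (suc n) k F = trans (cong (k * F 0 +_) (∑-* n k (F ∘ suc))) (sym (*-distribˡ-+ k (F 0) _))

∑-swap : ∀ m n (F : ℕ → ℕ → ℕ) → ∑ m (λ i → ∑ n (F i)) ≡ ∑ n (λ j → ∑ m (λ i → F i j))
∑-swap zero    n F = sym (∑-zero n (λ _ → refl))
∑-swap (suc m) n F = trans (cong (∑ n (F 0) +_) (∑-swap m n (F ∘ suc))) (sym (∑-+ n (F 0) _))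

∑-from : ∀ k n (F : ℕ → ℕ) → ∑ (k + n) (λ i → ind (k <? suc i) * F i) ≡ ∑ n (λ i → F (k + i))
∑-from zero    n F = ∑-cong {n} (λ _ → +-identityʳ _)
∑-from (suc k) n F = trans
  (∑-cong {k + n} (λ {i} _ → cong (_* F (suc i))
    (ind-cong (suc k <? suc (suc i)) (k <? suc i) (mk⇔ ≤-pred s≤s))))
  (∑-from k n (F ∘ suc))

-- Counts of permutations as sums of indicators

ind-× : ∀ {P Q : Set} (P? : Dec P) (Q? : Dec Q) → ind (P? ×-dec Q?) ≡ ind P? * ind Q?
ind-× (yes _) Q? with does Q?
... | true  = refl
... | false = refl
ind-× (no _)  Q? = refl

length-filter : ∀ {A : Set} {P : A → Set} (P? : Decidable P) xs →
  length (filter P? xs) ≡ sum (List.map (ind ∘ P?) xs)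
length-filter P? []       = refl
length-filter P? (x ∷ xs) with does (P? x)
... | true  = cong suc (length-filter P? xs)
... | false = length-filter P? xs

permSum-+ : ∀ {n} (F G : Vec ℕ n → ℕ) → permSum n (λ w → F w + G w) ≡ permSum n F + permSum n G
permSum-+ F G = sum-map-+ F G (S _)

permSum-zero : ∀ {n} {F : Vec ℕ n → ℕ} → (∀ {w} → IsPermutation w → F w ≡ 0) → permSum n F ≡ 0
permSum-zero {n} {F} F≡0 = trans (permSum-cong F≡0) (sum-map-* 0 F (S n))

permSum-ind-first : ∀ {n} {P : Vec ℕ (suc n) → Set} (P? : Decidable P) {e} → e < suc n →
  (∀ i w → P (ins (suc i) w) → i ≡ e) →
  permSum (suc n) (ind ∘ P?) ≡ permSum n (λ w → ind (P? (ins (suc e) w)))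
permSum-ind-first {n} P? e≤n P⇒≡ = trans (permSum-suc n (ind ∘ P?))
  (∑-single (suc n) e≤n (λ _ i≢e → permSum-zero {n} (λ {w} _ → ind-no (P? (ins _ w)) (i≢e ∘ P⇒≡ _ w))))

permSum-ind-second : ∀ {n} {P : Vec ℕ (2 + n) → Set} (P? : Decidable P) {e f} → e < 2 + n → f < 1 + n →
  (∀ i w → P (ins (suc i) w) → i ≡ e) → (∀ i w → P (ins (suc e) (ins (suc i) w)) → i ≡ f) →
  permSum (2 + n) (ind ∘ P?) ≡ permSum n (λ w → ind (P? (ins (suc e) (ins (suc f) w))))
permSum-ind-second P? {e} e< f< P⇒₁ P⇒₂ =
  trans (permSum-ind-first P? e< P⇒₁) (permSum-ind-first (P? ∘ ins (suc e)) f< P⇒₂)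

permSum-ind-χ : ∀ ρ {n m} {P : Vec ℕ m → Set} (P? : Decidable P) (h : Vec ℕ n → Vec ℕ m) →
  (∀ w → P (h w) ⇔ Avoids ρ (h w)) → permSum n (λ w → ind (P? (h w))) ≡ permSum n (χ ρ ∘ h)
permSum-ind-χ ρ P? h P⇔ = permSum-cong λ {w} _ →
  trans (ind-cong (P? (h w)) (avoids? ρ (h w)) (P⇔ w)) (sym (χ≡ind ρ (h w)))

T≡permSum : ∀ n ρ → T n ρ ≡ permSum n (χ ρ)
T≡permSum n ρ = trans (length-filter (avoids? ρ) (S n))
  (permSum-ind-χ ρ {n} {n} {Avoids ρ} (avoids? ρ) id (λ _ → mk⇔ id id))

-- Counts by the first one or two entries

opaque
  -- The index `m` is the number of entries left free: `first` concerns length `1 + m` and `second`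
  -- length `2 + m`. In `second` the entry `d` is standardised, so the actual second entry is
  -- `bump c d`.
  first : Pattern → ℕ → ℕ → ℕ
  first ρ m c = permSum m (λ w → χ ρ (ins c w))

  second : Pattern → ℕ → ℕ → ℕ → ℕ
  second ρ m c d = permSum m (λ w → χ ρ (ins c (ins d w)))

  deficit : Pattern → ℕ → ℕ → ℕ → ℕ
  deficit ρ t m c = permSum m (λ w → ind (highDescent? t c w) * χ ρ w)

  T₁≡first : ∀ m ρ {k} → InRange (suc m) k → T₁ (suc m) ρ k ≡ first ρ m k
  T₁≡first m ρ {suc e} (_ , e<1+m) = begin
    T₁ (suc m) ρ (suc e)                     ≡⟨ length-filter P? (S (suc m)) ⟩
    permSum (suc m) (ind ∘ P?)               ≡⟨ permSum-ind-first {m} {P} P? {e} e<1+m P⇒ ⟩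
    permSum m (λ w → ind (P? (ins (suc e) w))) ≡⟨ permSum-ind-χ ρ {P = P} P? (ins (suc e)) P⇔ ⟩
    first ρ m (suc e)                        ∎
    where
    P : Vec ℕ (suc m) → Set
    P π = Avoids ρ π × Entry 1 (suc e) π
    P? : Decidable P
    P? π = avoids? ρ π ×-dec entry? 1 (suc e) π
    P⇒ : ∀ i w → P (ins (suc i) w) → i ≡ e
    P⇒ _ _ (_ , zero , _ , eq) = suc-injective eq
    P⇔ : ∀ w → P (ins (suc e) w) ⇔ Avoids ρ (ins (suc e) w)
    P⇔ w = mk⇔ proj₁ (λ av → av , zero , refl , refl)

  T₂≡second : ∀ m ρ {k d} → InRange (2 + m) k → InRange (1 + m) d →
    T₂ (2 + m) ρ k (bump k d) ≡ second ρ m k d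
  T₂≡second m ρ {suc e} {suc f} (_ , e<2+m) (_ , f<1+m) = begin
    T₂ (2 + m) ρ (suc e) (bump (suc e) (suc f))
      ≡⟨ length-filter P? (S (2 + m)) ⟩
    permSum (2 + m) (ind ∘ P?)
      ≡⟨ permSum-ind-second {n = m} {P} P? {e} {f} e<2+m f<1+m P⇒₁ P⇒₂ ⟩
    permSum m (λ w → ind (P? (ins (suc e) (ins (suc f) w))))
      ≡⟨ permSum-ind-χ ρ {P = P} P? (λ w → ins (suc e) (ins (suc f) w)) P⇔ ⟩
    second ρ m (suc e) (suc f) ∎
    where
    P : Vec ℕ (2 + m) → Set
    P π = Avoids ρ π × Entry 1 (suc e) π × Entry 2 (bump (suc e) (suc f)) π
    P? : Decidable P
    P? π = avoids? ρ π ×-dec entry? 1 (suc e) π ×-dec entry? 2 (bump (suc e) (suc f)) π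
    P⇒₁ : ∀ i w → P (ins (suc i) w) → i ≡ e
    P⇒₁ _ _ (_ , (zero , _ , eq) , _) = suc-injective eq
    P⇒₂ : ∀ i w → P (ins (suc e) (ins (suc i) w)) → i ≡ f
    P⇒₂ _ _ (_ , _ , suc zero , _ , eq) = suc-injective (bump-injective (suc e) eq)
    P⇔ : ∀ w → P (ins (suc e) (ins (suc f) w)) ⇔ Avoids ρ (ins (suc e) (ins (suc f) w))
    P⇔ w = mk⇔ proj₁ (λ av → av , (zero , refl , refl) , (suc zero , refl , refl))

  T≡∑first : ∀ m ρ → T (suc m) ρ ≡ ∑ (suc m) (λ i → first ρ m (suc i))
  T≡∑first m ρ = trans (T≡permSum (suc m) ρ) (permSum-suc m (χ ρ))

  first-suc : ∀ ρ m c → first ρ (suc m) c ≡ ∑ (suc m) (λ i → second ρ m c (suc i))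
  first-suc ρ m c = permSum-suc m (λ w → χ ρ (ins c w))

  -- The entry `b` of a high descent is at most `m`, so `c ≤ suc b` is impossible.
  deficit-beyond : ∀ ρ t {m c} → suc m < c → deficit ρ t m c ≡ 0
  deficit-beyond ρ t {m} {c} 1+m<c = permSum-zero {m} λ {w} perm →
    cong (_* χ ρ w) (ind-no (highDescent? t c w) (low perm refl))
    where
    low : ∀ {n} {w : Vec ℕ n} → IsPermutation w → n ≡ m → ¬ HighDescent t c w
    low {w = a ∷ b ∷ _} ((_ ∷ (_ , b≤m) ∷ _) , _) refl (c≤1+b , _) = <⇒≱ 1+m<c (≤-trans c≤1+b (s≤s b≤m))

opaque
  unfolding first second deficit

  second-free : ∀ {ρ s t} → StartsAt ρ s t → ∀ {m c d} → 1 ≤ d → ¬ s + d < c → second ρ m c d ≡ first ρ m d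
  second-free at {m} 1≤d ≮ = permSum-cong {m} (λ perm → χ-free at perm 1≤d ≮)

  second-restricted : ∀ {ρ s t} → StartsAt ρ s t → ∀ {m c d} → 1 ≤ d → s + d < c →
    second ρ m c d + deficit ρ t m c ≡ first ρ m d
  second-restricted {ρ} {t = t} at {m} {c} {d} 1≤d s+d<c = trans
    (sym (permSum-+ {m} (λ w → χ ρ (ins c (ins d w))) (λ w → ind (highDescent? t c w) * χ ρ w)))
    (permSum-cong {m} (λ perm → χ-restricted at perm 1≤d s+d<c))

-- No entry exceeds such a first entry, so it begins no occurrence: even a restricted descent loses
-- nothing, its deficit being zero.
second-beyond : ∀ {ρ s t} → StartsAt ρ s t → ∀ {m c d} → 1 ≤ d → suc m < c → second ρ m c d ≡ first ρ m d
second-beyond {ρ} {s} {t} at {m} {c} {d} 1≤d 1+m<c with s + d <? c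
... | no  ≮ = second-free at 1≤d ≮
... | yes s+d<c = begin
  second ρ m c d                   ≡⟨ +-identityʳ _ ⟨
  second ρ m c d + 0               ≡⟨ cong (second ρ m c d +_) (deficit-beyond ρ t 1+m<c) ⟨
  second ρ m c d + deficit ρ t m c ≡⟨ second-restricted at 1≤d s+d<c ⟩
  first ρ m d                      ∎

-- The deficit expressed through shorter avoiders

-- Counts the avoiders of length `2 + m` that start with a descent by more than `t` to the entry
-- `v`. Lying below the first entry, `v` is unchanged by standardising.
column : Pattern → ℕ → ℕ → ℕ → ℕ
column ρ t m v = ∑ (2 + m) (λ u → ind (t + v <? suc u) * second ρ m (suc u) v)

-- Either side forces `v < u`, and then `bump u v` is `v`.
highDescent-ins : ∀ t c u v {n} (w : Vec ℕ n) →
  HighDescent t c (ins u (ins v w)) ⇔ (c ≤ suc v × t + v < u)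
highDescent-ins t c u v w = mk⇔ unbumped bumped
  where
  unbumped : c ≤ suc (bump u v) × t + bump u v < u → c ≤ suc v × t + v < u
  unbumped (c≤ , t+b<u) = subst (λ x → c ≤ suc x × t + x < u) (bump-< v<u) (c≤ , t+b<u)
    where v<u = ≤-<-trans (≤-bump u v) (≤-<-trans (m≤n+m (bump u v) t) t+b<u)
  bumped : c ≤ suc v × t + v < u → c ≤ suc (bump u v) × t + bump u v < u
  bumped (c≤ , t+v<u) =
    subst (λ x → c ≤ suc x × t + x < u) (sym (bump-< (≤-<-trans (m≤n+m v t) t+v<u))) (c≤ , t+v<u)

permSum-* : ∀ {n} k (F : Vec ℕ n → ℕ) → permSum n (λ w → k * F w) ≡ k * permSum n F
permSum-* k F = sum-map-* k F (S _)

opaque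
  unfolding second deficit

  -- `HighDescent` reads only the first two entries, and its condition on `c` only the second, so
  -- that condition factors out of each column. The second entry is `suc v`, whence `c ≤ 2 + v`.
  deficit-columns : ∀ ρ t m c →
    deficit ρ t (2 + m) c ≡ ∑ (1 + m) (λ v → ind (c ≤? 2 + v) * column ρ t m (suc v))
  deficit-columns ρ t m c = begin
    deficit ρ t (2 + m) c
      ≡⟨ permSum-suc (suc m) weight ⟩
    ∑ (2 + m) (λ u → permSum (suc m) (λ w → weight (ins (suc u) w)))
      ≡⟨ ∑-cong {2 + m} (λ {u} _ → permSum-suc m (λ w → weight (ins (suc u) w))) ⟩
    ∑ (2 + m) (λ u → ∑ (1 + m) (λ v → permSum m (λ w → weight (ins (suc u) (ins (suc v) w)))))
      ≡⟨ ∑-cong {2 + m} (λ {u} _ → ∑-cong {1 + m} (λ {v} _ → entry u v)) ⟩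
    ∑ (2 + m) (λ u → ∑ (1 + m) (λ v → ind (c ≤? 2 + v) * term u v))
      ≡⟨ ∑-swap (2 + m) (1 + m) (λ u v → ind (c ≤? 2 + v) * term u v) ⟩
    ∑ (1 + m) (λ v → ∑ (2 + m) (λ u → ind (c ≤? 2 + v) * term u v))
      ≡⟨ ∑-cong {1 + m} (λ {v} _ → ∑-* (2 + m) (ind (c ≤? 2 + v)) (λ u → term u v)) ⟩
    ∑ (1 + m) (λ v → ind (c ≤? 2 + v) * column ρ t m (suc v)) ∎
    where
    weight : Vec ℕ (2 + m) → ℕ
    weight w = ind (highDescent? t c w) * χ ρ w
    term : ℕ → ℕ → ℕ
    term u v = ind (t + suc v <? suc u) * second ρ m (suc u) (suc v)
    entry : ∀ u v → permSum m (λ w → weight (ins (suc u) (ins (suc v) w))) ≡ ind (c ≤? 2 + v) * term u v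
    entry u v = begin
      permSum m (λ w → weight (ins (suc u) (ins (suc v) w)))
        ≡⟨ permSum-cong {m} (λ {w} _ → cong (_* χ ρ (ins (suc u) (ins (suc v) w))) (trans
             (ind-cong (highDescent? t c (ins (suc u) (ins (suc v) w))) (p? ×-dec q?)
               (highDescent-ins t c (suc u) (suc v) w))
             (ind-× p? q?))) ⟩
      permSum m (λ w → ind p? * ind q? * χ ρ (ins (suc u) (ins (suc v) w)))
        ≡⟨ permSum-* {m} (ind p? * ind q?) (λ w → χ ρ (ins (suc u) (ins (suc v) w))) ⟩
      ind p? * ind q? * second ρ m (suc u) (suc v)
        ≡⟨ *-assoc (ind p?) (ind q?) _ ⟩
      ind p? * term u v ∎
      where
      p? : Dec (c ≤ 2 + v)
      p? = c ≤? 2 + v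
      q? : Dec (t + suc v < suc u)
      q? = t + suc v <? suc u

-- The cyclic shift between the counts of σ and τ

-- The induction hypothesis: `k` for σ corresponds to `suc k` for τ, and the top entry `suc m` to 1.
-- Deficits are compared from `k = 2` on, the least first entry from which σ can descend.
record Shift (m : ℕ) : Set where
  field
    first-shift   : ∀ {k} → 1 ≤ k → k ≤ m → first σ m k ≡ first τ m (suc k)
    first-wrap    : first σ m (suc m) ≡ first τ m 1
    deficit-shift : ∀ {k} → 2 ≤ k → k ≤ suc m → deficit σ 1 m k ≡ deficit τ 0 m (suc k)

  -- `suc ℓ < k` makes both pairs restricted, for τ because its descent from `suc k` to `suc ℓ` is
  -- by at least 2; the equal deficits then cancel.
  second-shift : ∀ {k ℓ} → 1 ≤ ℓ → suc ℓ < k → k ≤ suc m → second σ m k ℓ ≡ second τ m (suc k) (suc ℓ)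
  second-shift {k} {ℓ} 1≤ℓ 1+ℓ<k k≤1+m = +-cancelʳ-≡ (deficit σ 1 m k) _ _ (begin
    second σ m k ℓ + deficit σ 1 m k
      ≡⟨ second-restricted σ-starts 1≤ℓ (<-trans (n<1+n ℓ) 1+ℓ<k) ⟩
    first σ m ℓ
      ≡⟨ first-shift 1≤ℓ (≤-pred (≤-pred (≤-trans 1+ℓ<k (m≤n⇒m≤1+n k≤1+m)))) ⟩
    first τ m (suc ℓ)
      ≡⟨ second-restricted τ-starts (s≤s z≤n) (s≤s 1+ℓ<k) ⟨
    second τ m (suc k) (suc ℓ) + deficit τ 0 m (suc k)
      ≡⟨ cong (second τ m (suc k) (suc ℓ) +_)
           (deficit-shift (≤-trans (s≤s (≤-trans 1≤ℓ (n≤1+n ℓ))) 1+ℓ<k) k≤1+m) ⟨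
    second τ m (suc k) (suc ℓ) + deficit σ 1 m k ∎)

  -- Row k for σ and row suc k for τ agree after a cyclic shift, except that the
  -- restriction moves from the entry d = k ∸ 1 of σ to the entry d = 1 of τ.
  first-suc-shift : ∀ {k} → 1 ≤ k → k ≤ suc m → first σ (suc m) k ≡ first τ (suc m) (suc k)
  first-suc-shift {suc zero} _ _ = begin
    first σ (suc m) 1                       ≡⟨ first-suc σ m 1 ⟩
    ∑ (suc m) (λ i → second σ m 1 (suc i))
      ≡⟨ ∑-cyclic m (λ i → second σ m 1 (suc i)) (λ i → second τ m 2 (suc i)) row wrap ⟩
    ∑ (suc m) (λ i → second τ m 2 (suc i))  ≡⟨ first-suc τ m 2 ⟨
    first τ (suc m) 2                       ∎
    where
    row : ∀ {i} → i < m → second σ m 1 (suc i) ≡ second τ m 2 (2 + i)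
    row i<m = trans (second-free σ-starts (s≤s z≤n) λ { (s≤s ()) }) (trans (first-shift (s≤s z≤n) i<m)
      (sym (second-free τ-starts (s≤s z≤n) λ { (s≤s (s≤s ())) })))
    wrap : second σ m 1 (suc m) ≡ second τ m 2 1
    wrap = trans (second-free σ-starts (s≤s z≤n) λ { (s≤s ()) }) (trans first-wrap
      (sym (second-free τ-starts (s≤s z≤n) λ { (s≤s (s≤s ())) })))
  first-suc-shift {suc (suc e)} 1≤k (s≤s e<m) = begin
    first σ (suc m) k                       ≡⟨ first-suc σ m k ⟩
    ∑ (suc m) h                             ≡⟨ ∑-last m h ⟩
    ∑ m h + h m                             ≡⟨ cong (∑ m h +_) wrap ⟩
    ∑ m h + (h′ 0 + deficit σ 1 m k)        ≡⟨ x+[y+z]≡y+[x+z] (∑ m h) (h′ 0) _ ⟩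
    h′ 0 + (∑ m h + deficit σ 1 m k)        ≡⟨ cong (h′ 0 +_) (∑-adjust m e<m diagonal off-diagonal) ⟩
    ∑ (suc m) h′                            ≡⟨ first-suc τ m (suc k) ⟨
    first τ (suc m) (suc k)                 ∎
    where
    k = suc (suc e)
    h h′ : ℕ → ℕ
    h  i = second σ m k (suc i)
    h′ i = second τ m (suc k) (suc i)
    wrap : h m ≡ h′ 0 + deficit σ 1 m k
    wrap = begin
      h m                        ≡⟨ second-free σ-starts (s≤s z≤n) (≤⇒≯ (s≤s e<m)) ⟩
      first σ m (suc m)          ≡⟨ first-wrap ⟩
      first τ m 1                ≡⟨ second-restricted τ-starts (s≤s z≤n) (s≤s (s≤s (s≤s z≤n))) ⟨
      h′ 0 + deficit τ 0 m (suc k) ≡⟨ cong (h′ 0 +_) (deficit-shift (s≤s (s≤s z≤n)) (s≤s e<m)) ⟨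
      h′ 0 + deficit σ 1 m k     ∎
    diagonal : h e + deficit σ 1 m k ≡ h′ (suc e)
    diagonal = begin
      h e + deficit σ 1 m k ≡⟨ second-restricted σ-starts (s≤s z≤n) (n<1+n (suc e)) ⟩
      first σ m (suc e)     ≡⟨ first-shift (s≤s z≤n) e<m ⟩
      first τ m k           ≡⟨ second-free τ-starts (s≤s z≤n) (n≮n (suc k)) ⟨
      h′ (suc e)            ∎
    off-diagonal : ∀ {i} → i < m → i ≢ e → h i ≡ h′ (suc i)
    -- Entries below `k ∸ 1` are restricted for σ and so are their partners for τ; from `k` on both
    -- are free.
    off-diagonal {i} i<m i≢e with <-cmp i e
    ... | tri< i<e _ _ = second-shift (s≤s z≤n) (s≤s (s≤s i<e)) (s≤s e<m)
    ... | tri≈ _ i≡e _ = contradiction i≡e i≢e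
    ... | tri> _ _ e<i = begin
      h i               ≡⟨ second-free σ-starts (s≤s z≤n) (≤⇒≯ (s≤s e<i)) ⟩
      first σ m (suc i) ≡⟨ first-shift (s≤s z≤n) i<m ⟩
      first τ m (2 + i) ≡⟨ second-free τ-starts (s≤s z≤n) (≤⇒≯ (s≤s (s≤s (m≤n⇒m≤1+n e<i)))) ⟨
      h′ (suc i)        ∎

  ∑first : ∑ (suc m) (λ i → first σ m (suc i)) ≡ ∑ (suc m) (λ i → first τ m (suc i))
  ∑first = ∑-cyclic m (first σ m ∘ suc) (first τ m ∘ suc) (first-shift (s≤s z≤n)) first-wrap

  -- The largest first entry cannot begin 2153-4 and the least cannot begin 3154-2, so both sides
  -- count all avoiders of length `suc m`.
  first-suc-wrap : first σ (suc m) (2 + m) ≡ first τ (suc m) 1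
  first-suc-wrap = begin
    first σ (suc m) (2 + m)
      ≡⟨ first-suc σ m (2 + m) ⟩
    ∑ (suc m) (λ i → second σ m (2 + m) (suc i))
      ≡⟨ ∑-cong {suc m} {second σ m (2 + m) ∘ suc} {first σ m ∘ suc}
           (λ _ → second-beyond σ-starts (s≤s z≤n) (n<1+n (suc m))) ⟩
    ∑ (suc m) (λ i → first σ m (suc i))
      ≡⟨ ∑first ⟩
    ∑ (suc m) (λ i → first τ m (suc i))
      ≡⟨ ∑-cong {suc m} {second τ m 1 ∘ suc} {first τ m ∘ suc}
           (λ _ → second-free τ-starts (s≤s z≤n) λ { (s≤s ()) }) ⟨
    ∑ (suc m) (λ i → second τ m 1 (suc i))
      ≡⟨ first-suc τ m 1 ⟨
    first τ (suc m) 1 ∎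

  -- Both columns run over the first entries from `3 + i` to `2 + m`, and `second-shift` moves each
  -- by one. The top entry for σ is paired with the descent by exactly 1 for τ; neither begins an
  -- occurrence.
  column-shift : ∀ {i} → i < m → column σ 1 m (suc i) ≡ column τ 0 m (2 + i)
  column-shift {i} i<m with q , refl ← m≤n⇒∃[o]m+o≡n i<m = begin
    column σ 1 m (suc i)
      ≡⟨ split (λ u → second σ m (suc u) (suc i)) ⟩
    ∑ (suc q) (λ j → second σ m (3 + i + j) (suc i))
      ≡⟨ ∑-cyclic q (λ j → second σ m (3 + i + j) (suc i)) (λ j → second τ m (3 + i + j) (2 + i)) step wrap ⟩
    ∑ (suc q) (λ j → second τ m (3 + i + j) (2 + i))
      ≡⟨ split (λ u → second τ m (suc u) (2 + i)) ⟨
    column τ 0 m (2 + i) ∎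
    where
    -- The threshold `t + v` is `2 + i` in both columns.
    split : ∀ (F : ℕ → ℕ) → ∑ (3 + (i + q)) (λ u → ind (2 + i <? suc u) * F u) ≡ ∑ (suc q) (λ j → F (2 + i + j))
    split F = trans (cong (λ N → ∑ N (λ u → ind (2 + i <? suc u) * F u)) (cong (2 +_) (sym (+-suc i q))))
                    (∑-from (2 + i) (suc q) F)
    step : ∀ {j} → j < q → second σ m (3 + i + j) (suc i) ≡ second τ m (3 + i + suc j) (2 + i)
    step {j} j<q = trans
      (second-shift (s≤s z≤n) (s≤s (s≤s (s≤s (m≤m+n i j))))
        (s≤s (s≤s (subst (_≤ i + q) (+-suc i j) (+-monoʳ-≤ i j<q)))))
      (cong (λ c → second τ m c (2 + i)) (cong (3 +_) (sym (+-suc i j))))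
    wrap : second σ m (3 + i + q) (suc i) ≡ second τ m (3 + i + 0) (2 + i)
    wrap = begin
      second σ m (3 + i + q) (suc i) ≡⟨ second-beyond σ-starts (s≤s z≤n) (n<1+n _) ⟩
      first σ m (suc i)              ≡⟨ first-shift (s≤s z≤n) i<m ⟩
      first τ m (2 + i)              ≡⟨ second-free τ-starts (s≤s z≤n) (≤⇒≯ (≤-reflexive (cong (3 +_) (+-identityʳ i)))) ⟨
      second τ m (3 + i + 0) (2 + i) ∎

  -- The columns match after a rotation. The two left over vanish: no first entry is large enough
  -- for the last column of σ, and `2 ≤ k` excludes the column of τ with second entry 1.
  deficit-suc-suc-shift : ∀ {k} → 2 ≤ k → deficit σ 1 (2 + m) k ≡ deficit τ 0 (2 + m) (suc k)
  deficit-suc-suc-shift {k} 2≤k = begin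
    deficit σ 1 (2 + m) k
      ≡⟨ deficit-columns σ 1 m k ⟩
    ∑ (1 + m) (λ v → ind (k ≤? 2 + v) * column σ 1 m (suc v))
      ≡⟨ ∑-cyclic m (λ v → ind (k ≤? 2 + v) * column σ 1 m (suc v))
           (λ v → ind (suc k ≤? 2 + v) * column τ 0 m (suc v)) step (trans last-zero (sym head-zero)) ⟩
    ∑ (1 + m) (λ v → ind (suc k ≤? 2 + v) * column τ 0 m (suc v))
      ≡⟨ deficit-columns τ 0 m (suc k) ⟨
    deficit τ 0 (2 + m) (suc k) ∎
    where
    step : ∀ {i} → i < m → ind (k ≤? 2 + i) * column σ 1 m (suc i) ≡ ind (suc k ≤? 3 + i) * column τ 0 m (2 + i)
    step {i} i<m = cong₂ _*_ (ind-cong (k ≤? 2 + i) (suc k ≤? 3 + i) (mk⇔ s≤s ≤-pred)) (column-shift i<m)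
    last-zero : ind (k ≤? 2 + m) * column σ 1 m (suc m) ≡ 0
    last-zero = trans
      (cong (ind (k ≤? 2 + m) *_) (∑-zero (2 + m) (λ {u} u<2+m →
        cong (_* second σ m (suc u) (suc m)) (ind-no (2 + m <? suc u) (≤⇒≯ u<2+m)))))
      (*-zeroʳ (ind (k ≤? 2 + m)))
    head-zero : ind (suc k ≤? 2) * column τ 0 m 1 ≡ 0
    head-zero = cong (_* column τ 0 m 1) (ind-no (suc k ≤? 2) (≤⇒≯ 2≤k))

open Shift

χ-[1] : ∀ {ρ} → χ ρ (1 ∷ []) ≡ χ ρ []
χ-[1] {ρ} = χ-ins {ρ} {c = 1} {w = []} λ ()

opaque
  unfolding first deficit

  first0 : first σ 0 1 ≡ first τ 0 1
  first0 = begin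
    first σ 0 1      ≡⟨ cong (_+ 0) (χ-[1] {σ}) ⟩
    permSum 0 (χ σ)  ≡⟨ T≡permSum 0 σ ⟨
    -- The empty permutation avoids every pattern, so both counts evaluate to 1.
    T 0 σ            ≡⟨⟩
    T 0 τ            ≡⟨ T≡permSum 0 τ ⟩
    permSum 0 (χ τ)  ≡⟨ cong (_+ 0) (χ-[1] {τ}) ⟨
    first τ 0 1      ∎

  -- A word with fewer than two entries has no descent, so both sides here and in `deficit-one`
  -- compute to 0.
  deficit-zero : ∀ c → deficit σ 1 0 c ≡ deficit τ 0 0 (suc c)
  deficit-zero c = refl

  deficit-one : ∀ c → deficit σ 1 1 c ≡ deficit τ 0 1 (suc c)
  deficit-one c = refl

-- Counts by first entry climb one length at a time but deficits two, so the deficits at lengths 0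
-- and 1 are both base cases.
shift : ∀ m → Shift m
shift zero = record
  { first-shift   = λ { (s≤s _) () }
  ; first-wrap    = first0
  ; deficit-shift = λ _ _ → deficit-zero _
  }
shift (suc m) = record
  { first-shift   = first-suc-shift (shift m)
  ; first-wrap    = first-suc-wrap (shift m)
  ; deficit-shift = deficit-shift-suc m
  }
  where
  deficit-shift-suc : ∀ m {k} → 2 ≤ k → k ≤ 2 + m → deficit σ 1 (suc m) k ≡ deficit τ 0 (suc m) (suc k)
  deficit-shift-suc zero    _   _ = deficit-one _
  deficit-shift-suc (suc m) 2≤k _ = deficit-suc-suc-shift (shift m) 2≤k

-- Translation to the counts `T`, `T₁` and `T₂`

-- An initial ascent begins no occurrence, so the first entry may be deleted; this lowers the second
-- entry from `suc ℓ` to `ℓ`.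
T₂-ascent : ∀ m {k ℓ} → 1 ≤ k → k ≤ ℓ → ℓ ≤ suc m → T₂ (2 + m) σ k (suc ℓ) ≡ first σ m ℓ
T₂-ascent m {k} {ℓ} 1≤k k≤ℓ ℓ≤1+m = begin
  T₂ (2 + m) σ k (suc ℓ)    ≡⟨ cong (T₂ (2 + m) σ k) (bump-≥ k≤ℓ) ⟨
  T₂ (2 + m) σ k (bump k ℓ)
    ≡⟨ T₂≡second m σ (1≤k , m≤n⇒m≤1+n (≤-trans k≤ℓ ℓ≤1+m)) (≤-trans 1≤k k≤ℓ , ℓ≤1+m) ⟩
  second σ m k ℓ            ≡⟨ second-free σ-starts (≤-trans 1≤k k≤ℓ) (≤⇒≯ k≤ℓ) ⟩
  first σ m ℓ               ∎

T₂-descent : ∀ m ρ {k ℓ} → 1 ≤ ℓ → ℓ < k → k ≤ 2 + m → T₂ (2 + m) ρ k ℓ ≡ second ρ m k ℓ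
T₂-descent m ρ {k} {ℓ} 1≤ℓ ℓ<k k≤2+m = begin
  T₂ (2 + m) ρ k ℓ          ≡⟨ cong (T₂ (2 + m) ρ k) (bump-< ℓ<k) ⟨
  T₂ (2 + m) ρ k (bump k ℓ)
    ≡⟨ T₂≡second m ρ (≤-trans 1≤ℓ (<⇒≤ ℓ<k) , k≤2+m) (1≤ℓ , ≤-pred (≤-trans ℓ<k k≤2+m)) ⟩
  second ρ m k ℓ            ∎

T₂-top : ∀ m {ℓ} → 1 ≤ ℓ → ℓ ≤ suc m → T₂ (2 + m) σ (2 + m) ℓ ≡ first σ m ℓ
T₂-top m 1≤ℓ ℓ≤1+m = trans (T₂-descent m σ 1≤ℓ (s≤s ℓ≤1+m) ≤-refl)
  (second-beyond σ-starts 1≤ℓ (n<1+n (suc m)))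

-- The first letter of 3154-2 has letters both above and below it, so neither the largest nor the
-- least first entry begins an occurrence.
first-τ-top : ∀ m → first τ (suc m) (2 + m) ≡ first τ (suc m) 1
first-τ-top m = begin
  first τ (suc m) (2 + m)
    ≡⟨ first-suc τ m (2 + m) ⟩
  ∑ (suc m) (second τ m (2 + m) ∘ suc)
    ≡⟨ ∑-cong {suc m} {second τ m (2 + m) ∘ suc} {second τ m 1 ∘ suc} (λ _ → trans
         (second-beyond τ-starts (s≤s z≤n) (n<1+n (suc m)))
         (sym (second-free τ-starts (s≤s z≤n) λ { (s≤s ()) }))) ⟩
  ∑ (suc m) (second τ m 1 ∘ suc)
    ≡⟨ first-suc τ m 1 ⟨
  first τ (suc m) 1 ∎

first-σ≡T₁-τ : ∀ m {k} → 1 ≤ k → k ≤ m → first σ m k ≡ T₁ (suc m) τ (suc k)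
first-σ≡T₁-τ m 1≤k k≤m = trans (first-shift (shift m) 1≤k k≤m) (sym (T₁≡first m τ (s≤s z≤n , s≤s k≤m)))

first-σ-top≡T₁-τ : ∀ m → first σ m (suc m) ≡ T₁ (suc m) τ 1
first-σ-top≡T₁-τ m = trans (first-wrap (shift m)) (sym (T₁≡first m τ (s≤s z≤n , s≤s z≤n)))

σ≡ᵂτ : σ ≡ᵂ τ
σ≡ᵂτ (suc m) _ = trans (T≡∑first m σ) (trans (∑first (shift m)) (sym (T≡∑first m τ)))

module _ (m : ℕ) where

  -- Deleting the first entry lowers the second by one and the shift from σ to τ raises it again, so
  -- `ℓ` reappears unchanged.
  T₂-σ-ascent : ∀ k ℓ → 1 ≤ k → k < ℓ → ℓ < 2 + m → T₂ (2 + m) σ k ℓ ≡ T₁ (1 + m) τ ℓ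
  T₂-σ-ascent k (suc ℓ) 1≤k (s≤s k≤ℓ) (s≤s ℓ<1+m) = trans (T₂-ascent m 1≤k k≤ℓ (<⇒≤ ℓ<1+m))
    (first-σ≡T₁-τ m (≤-trans 1≤k k≤ℓ) (≤-pred ℓ<1+m))

  T₂-σ-ascent-top : ∀ k → 1 ≤ k → k < 2 + m → T₂ (2 + m) σ k (2 + m) ≡ T₁ (1 + m) τ 1
  T₂-σ-ascent-top k 1≤k k<2+m =
    trans (T₂-ascent m 1≤k (≤-pred k<2+m) ≤-refl) (first-σ-top≡T₁-τ m)

  T₂-σ-top : ∀ ℓ → 1 ≤ ℓ → ℓ ≤ m → T₂ (2 + m) σ (2 + m) ℓ ≡ T₁ (1 + m) τ (ℓ + 1)
  T₂-σ-top ℓ 1≤ℓ ℓ≤m = trans (T₂-top m 1≤ℓ (m≤n⇒m≤1+n ℓ≤m)) (trans (first-σ≡T₁-τ m 1≤ℓ ℓ≤m)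
    (cong (T₁ (1 + m) τ) (+-comm 1 ℓ)))

  T₂-σ≡T₂-τ : ∀ k ℓ → 1 ≤ ℓ → suc ℓ < k → k < 2 + m →
    T₂ (2 + m) σ k ℓ ≡ T₂ (2 + m) τ (k + 1) (ℓ + 1)
  T₂-σ≡T₂-τ k ℓ 1≤ℓ 1+ℓ<k k<2+m = begin
    T₂ (2 + m) σ k ℓ             ≡⟨ T₂-descent m σ 1≤ℓ (<-trans (n<1+n ℓ) 1+ℓ<k) (<⇒≤ k<2+m) ⟩
    second σ m k ℓ               ≡⟨ second-shift (shift m) 1≤ℓ 1+ℓ<k (≤-pred k<2+m) ⟩
    second τ m (suc k) (suc ℓ)   ≡⟨ T₂-descent m τ (s≤s z≤n) (s≤s (<-trans (n<1+n ℓ) 1+ℓ<k)) k<2+m ⟨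
    T₂ (2 + m) τ (suc k) (suc ℓ) ≡⟨ cong₂ (T₂ (2 + m) τ) (+-comm 1 k) (+-comm 1 ℓ) ⟩
    T₂ (2 + m) τ (k + 1) (ℓ + 1) ∎

  T₁-σ≡T₁-τ : ∀ k → 1 ≤ k → k < suc m → T₁ (suc m) σ k ≡ T₁ (suc m) τ (k + 1)
  T₁-σ≡T₁-τ k 1≤k k<1+m = trans (T₁≡first m σ (1≤k , <⇒≤ k<1+m)) (trans (first-σ≡T₁-τ m 1≤k (≤-pred k<1+m))
    (cong (T₁ (suc m) τ) (+-comm 1 k)))

  T₁-σ-top : T₁ (suc m) σ (suc m) ≡ T₁ (suc m) τ 1
  T₁-σ-top = trans (T₁≡first m σ (s≤s z≤n , ≤-refl)) (first-σ-top≡T₁-τ m)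

-- Deleting the top entry leaves a permutation that again starts with its largest value. The shift
-- sends this value to 1, which for τ counts the same as the top.
T₂-σ-top-two : ∀ m → T₂ (3 + m) σ (3 + m) (2 + m) ≡ T₁ (2 + m) τ (2 + m)
T₂-σ-top-two m = begin
  T₂ (3 + m) σ (3 + m) (2 + m)  ≡⟨ T₂-top (suc m) (s≤s z≤n) ≤-refl ⟩
  first σ (suc m) (2 + m)       ≡⟨ first-wrap (shift (suc m)) ⟩
  first τ (suc m) 1             ≡⟨ first-τ-top m ⟨
  first τ (suc m) (2 + m)       ≡⟨ T₁≡first (suc m) τ (s≤s z≤n , ≤-refl) ⟨
  T₁ (2 + m) τ (2 + m)          ∎

theorem5p4 : (∀ (n : ℕ) → 5 ≤ n →
    (∀ (k ℓ : ℕ) → 1 ≤ k → k ≤ n → 1 ≤ ℓ → ℓ ≤ n → k ≢ ℓ →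
    (k < ℓ → ℓ < n → T₂ n σ k ℓ ≡ T₁ (n ∸ 1) τ ℓ) ×
    (k < ℓ → ℓ ≡ n → T₂ n σ k ℓ ≡ T₁ (n ∸ 1) τ 1)) ×
    (∀ (k ℓ : ℕ) → 1 ≤ k → k ≤ n → 1 ≤ ℓ → ℓ ≤ n → k ≢ ℓ →
    k ≡ n → ℓ ≢ n ∸ 1 → T₂ n σ n ℓ ≡ T₁ (n ∸ 1) τ (ℓ + 1)) ×
    (T₂ n σ n (n ∸ 1) ≡ T₁ (n ∸ 1) τ (n ∸ 1)) ×
    (∀ (k ℓ : ℕ) → 1 ≤ k → k ≤ n → 1 ≤ ℓ → ℓ ≤ n → k ≢ ℓ →
    k < n → ℓ + 1 < k → T₂ n σ k ℓ ≡ T₂ n τ (k + 1) (ℓ + 1)) ×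
    (∀ (k : ℕ) → 1 ≤ k → k < n → T₁ n σ k ≡ T₁ n τ (k + 1)) ×
    (T₁ n σ n ≡ T₁ n τ 1) ×
    (T n σ ≡ T n τ)) ×
    (σ ≡ᵂ τ)
theorem5p4 =
  (λ { (suc (suc (suc m))) (s≤s (s≤s (s≤s _))) →
    (λ k ℓ 1≤k _ _ _ _ →
      (λ k<ℓ ℓ<n → T₂-σ-ascent (suc m) k ℓ 1≤k k<ℓ ℓ<n) ,
      (λ { k<ℓ refl → T₂-σ-ascent-top (suc m) k 1≤k k<ℓ })) ,
    (λ { k ℓ _ _ 1≤ℓ ℓ≤n k≢ℓ refl ℓ≢n-1 →
      -- As `ℓ` differs from both `n` and `n ∸ 1`, it is at most `n ∸ 2`.
      T₂-σ-top (suc m) ℓ 1≤ℓ (≤-pred (≤∧≢⇒< (≤-pred (≤∧≢⇒< ℓ≤n (k≢ℓ ∘ sym))) ℓ≢n-1)) }) ,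
    T₂-σ-top-two m ,
    (λ k ℓ _ _ 1≤ℓ _ _ k<n ℓ+1<k → T₂-σ≡T₂-τ (suc m) k ℓ 1≤ℓ (subst (_< k) (+-comm ℓ 1) ℓ+1<k) k<n) ,
    T₁-σ≡T₁-τ (2 + m) ,
    T₁-σ-top (2 + m) ,
    σ≡ᵂτ (3 + m) (s≤s z≤n) }) ,
  σ≡ᵂτ
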